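{- Let $\Gamma$ be a finite graph with vertex set $V$ and let $h:V\to\mathbb Z$, $v_i\mapsto h_i$. For $m\in\mathbb Z$, $$\chi_{\Gamma,h}(m)=\sum_{\pi\in\Pi(\Gamma)}\mu(\hat 0,\pi)\prod_{W\in\pi}[m-h(W)]^+ ,$$ where $\mu$ is the M\"obius function of $\Pi(\Gamma)$ and $h(W):=\max\{h_i: v_i\in W\}$.
   Context: $\chi_{\Gamma,h}(m)$ is the number of functions $x:V\to\mathbb Z$ such that each $x_i=x(v_i)$ lies in the integer interval $(h_i,m]=\{h_i+1,\dots,m\}$ (empty if $m\le h_i$) and no two (distinct) adjacent vertices have the same color. $\Pi(\Gamma)$ is the set of partitions $\pi$ of $V$ such that each block of $\pi$ induces a connected subgraph of $\Gamma$, ordered by refinement with the partition $\hat 0$ into singletons as its least element. For real $r$, $r^+=\max(r,0)$. -}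

module Defs where

open import Data.Fin.Base using (Fin; zero; suc)
open import Data.Fin.Properties using (all?; any?) renaming (_≟_ to _≟ᶠ_)
open import Data.Fin.Subset
  using (Subset; inside; outside; _∈_; _⊆_; _∩_; Nonempty; Empty; ⁅_⁆)
open import Data.Fin.Subset.Properties
  using (_∈?_; _⊆?_; nonempty?; x∈p∩q⁺; x∈p∩q⁻; x∈⁅x⁆; x∈⁅y⁆⇒x≡y; ⊆-antisym)
open import Data.Integer.Base as ℤ using (ℤ; +_; 0ℤ; 1ℤ; _⊔_)
import Data.Integer.Properties as ℤ
open import Algebra.Properties.AbelianGroup ℤ.+-0-abelianGroup using (∙-cancelˡ)
open import Data.List.Base
  using (List; []; _∷_; _++_; map; foldr; filter; length; upTo; allFin;
         cartesianProductWith)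
import Data.List.Extrema ℤ.≤-totalOrder as Extrema
import Data.List.Membership.Propositional as L
import Data.List.Membership.Propositional.Properties as L
open import Data.List.Membership.DecPropositional using () renaming (_∈?_ to mem?)
open import Data.List.Relation.Unary.All as All using (All; []; _∷_)
import Data.List.Relation.Unary.All.Properties as All
open import Data.List.Relation.Unary.AllPairs as AllPairs using (AllPairs; []; _∷_)
import Data.List.Relation.Unary.AllPairs.Properties as AllPairs
open import Data.List.Relation.Unary.Any as Any using (Any; here; there)
import Data.List.Relation.Unary.Any.Properties as Any
open import Data.List.Relation.Unary.Enumerates.Setoid using (IsEnumeration)
import Data.List.Relation.Unary.Unique.Propositional as ≡-Unique
import Data.List.Relation.Unary.Unique.Propositional.Properties as ≡-Unique
open import Data.List.Relation.Unary.Unique.Setoid using (Unique)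
import Data.List.Relation.Unary.Unique.Setoid.Properties as Unique
open import Data.Nat.Base as ℕ using (ℕ; zero; suc; z≤n; s≤s)
open import Data.Nat.Induction using (<-wellFounded)
import Data.Nat.Properties as ℕ
open import Data.Product.Base using (∃; ∃-syntax; _×_; _,_; proj₁; proj₂)
open import Data.Product.Properties using () renaming (≡-dec to ×-≡-dec)
open import Data.Sum.Base using (_⊎_; inj₁; inj₂)
import Data.Vec.Functional as F
open import Data.Vec.Base using ([]; _∷_)
import Data.Vec.Properties as Vec
open import Data.Bool.Properties using () renaming (_≟_ to _≟ᵇ_)
open import Data.Unit.Base using (⊤; tt)
open import Function.Base using (_∘_; _on_; id)
open import Induction.WellFounded using (WellFounded; Acc; acc; module Subrelation)
open import Level using (0ℓ)
open import Relation.Binary.Bundles using (Setoid; DecPoset)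
open import Relation.Binary.Core using (Rel)
open import Relation.Binary.Structures using (IsStrictPartialOrder)
import Relation.Binary.Definitions as B
import Relation.Binary.Construct.On as On
import Relation.Binary.Construct.NonStrictToStrict as ToStrict
open import Relation.Binary.Construct.Closure.ReflexiveTransitive using (Star; ε; _◅_; _◅◅_)
open import Relation.Binary.PropositionalEquality
  using (_≡_; _≢_; _≗_; refl; sym; trans; cong; subst; _→-setoid_; setoid)
open import Relation.Nullary.Decidable
  using (yes; no; ¬?; _×-dec_; _⊎-dec_; _→-dec_; map′)
open import Relation.Nullary.Negation using (¬_; contradiction)
open import Relation.Unary using (Pred; Decidable)

private variable
  n : ℕ
  A : Set

-- A finite set, given by a list containing each element exactly once up to ≈.

record Finite (S : Setoid 0ℓ 0ℓ) : Set where
  open Setoid S using (Carrier)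
  field
    elements  : List Carrier
    complete  : IsEnumeration S elements
    unique    : Unique S elements

open Finite public using (elements)

card : {S : Setoid 0ℓ 0ℓ} → Finite S → ℕ
card F = length (elements F)

sumOver : {S : Setoid 0ℓ 0ℓ} → Finite S → (Setoid.Carrier S → ℤ) → ℤ
sumOver F f = foldr ℤ._+_ 0ℤ (map f (elements F))

infix 5 sumOver
syntax sumOver F (λ x → t) = ∑[ x ∈ F ] t

satisfying : {P : Pred A 0ℓ} → Decidable P → List A → List (∃ P)
satisfying P? [] = []
satisfying P? (x ∷ xs) with P? x
... | yes px = (x , px) ∷ satisfying P? xs
... | no  _  = satisfying P? xs

module _ (S : Setoid 0ℓ 0ℓ) {P : Pred (Setoid.Carrier S) 0ℓ} (P? : Decidable P) where
  open Setoid S using (_≈_)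

  private
    All-satisfying : {Q : Pred _ 0ℓ} → ∀ {xs} → All Q xs → All (Q ∘ proj₁) (satisfying P? xs)
    All-satisfying [] = []
    All-satisfying {xs = x ∷ _} (q ∷ qs) with P? x
    ... | yes _ = q ∷ All-satisfying qs
    ... | no  _ = All-satisfying qs

    Any-satisfying : ∀ {x xs} → P x → x L.∈ xs → Any ((x ≡_) ∘ proj₁) (satisfying P? xs)
    Any-satisfying {xs = y ∷ _} px (here refl) with P? y
    ... | yes _  = here refl
    ... | no ¬py = contradiction px ¬py
    Any-satisfying {xs = y ∷ _} px (there x∈xs) with P? y
    ... | yes _ = there (Any-satisfying px x∈xs)
    ... | no  _ = Any-satisfying px x∈xs

    Unique-satisfying : ∀ {xs} → Unique S xs → Unique (On.setoid S proj₁) (satisfying P? xs)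
    Unique-satisfying [] = []
    Unique-satisfying {x ∷ _} (x∉ ∷ u) with P? x
    ... | yes _ = All-satisfying x∉ ∷ Unique-satisfying u
    ... | no  _ = Unique-satisfying u

  finiteSubset : ∀ xs → Unique S xs →
                 (∀ x → P x → ∃[ y ] y L.∈ xs × P y × x ≈ y) →
                 Finite (On.setoid {B = ∃ P} S proj₁)
  finiteSubset xs u representative = record
    { elements = satisfying P? xs
    ; complete = λ (x , px) → let (y , y∈xs , py , x≈y) = representative x px in
                   Any.map (λ y≡z → subst (x ≈_) y≡z x≈y) (Any-satisfying py y∈xs)
    ; unique   = Unique-satisfying u
    }

module _ {P Q : Pred A 0ℓ} (P? : Decidable P) (Q? : Decidable Q) (P⊆Q : ∀ {x} → P x → Q x) where

  length-filter-≤ : ∀ xs → length (filter P? xs) ℕ.≤ length (filter Q? xs)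
  length-filter-≤ [] = z≤n
  length-filter-≤ (x ∷ xs) with P? x | Q? x
  ... | yes _ | yes _ = s≤s (length-filter-≤ xs)
  ... | yes p | no ¬q = contradiction (P⊆Q p) ¬q
  ... | no  _ | yes _ = ℕ.m≤n⇒m≤1+n (length-filter-≤ xs)
  ... | no  _ | no  _ = length-filter-≤ xs

  length-filter-< : ∀ {xs} → Any (λ x → ¬ P x × Q x) xs →
                    length (filter P? xs) ℕ.< length (filter Q? xs)
  length-filter-< {x ∷ xs} any with P? x | Q? x | any
  ... | yes p | _     | here (¬p , _) = contradiction p ¬p
  ... | no  _ | yes _ | here _        = s≤s (length-filter-≤ xs)
  ... | no  _ | no ¬q | here (_ , q)  = contradiction q ¬q
  ... | yes _ | yes _ | there any′    = s≤s (length-filter-< any′)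
  ... | yes p | no ¬q | there _       = contradiction (P⊆Q p) ¬q
  ... | no  _ | yes _ | there any′    = ℕ.m≤n⇒m≤1+n (length-filter-< any′)
  ... | no  _ | no  _ | there any′    = length-filter-< any′

module Möbius (P : DecPoset 0ℓ 0ℓ 0ℓ) (F : Finite (DecPoset.Eq.setoid P)) where
  open DecPoset P using (Carrier; _≈_; _≤_; _≤?_; _≟_; isPartialOrder)
  open ToStrict _≈_ _≤_ using (_<_; <-decidable; <-isStrictPartialOrder)
  open IsStrictPartialOrder (<-isStrictPartialOrder isPartialOrder)
    using () renaming (trans to <-trans; irrefl to <-irrefl; <-respˡ-≈ to <-respˡ)

  _<?_ : B.Decidable _<_
  _<?_ = <-decidable _≟_ _≤?_

  private
    #below : Carrier → ℕ
    #below y = length (filter (_<? y) (elements F))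

    #below-mono : ∀ {x y} → x < y → #below x ℕ.< #below y
    #below-mono {x} {y} x<y = length-filter-< (_<? x) (_<? y) (λ z<x → <-trans z<x x<y)
      (Any.map (λ x≈z → <-irrefl (DecPoset.Eq.sym P x≈z) , <-respˡ x≈z x<y) (Finite.complete F x))

  <-wf : WellFounded _<_
  <-wf = Subrelation.wellFounded {_<₂_ = ℕ._<_ on #below} #below-mono
           (On.wellFounded #below <-wellFounded)

  -- μ(x,y) = 1 if x = y, - ∑_{x ≤ z < y} μ(x,z) if x < y, and 0 otherwise.
  -- μ-below x y _ z is the summand for z, with value 0 unless x ≤ z < y.
  μ-acc   : (x y : Carrier) → Acc _<_ y → ℤ
  μ-below : (x y : Carrier) → (∀ {z} → z < y → Acc _<_ z) → Carrier → ℤ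

  μ-acc x y (acc rec) with x ≟ y | x ≤? y
  ... | yes _ | _     = 1ℤ
  ... | no  _ | yes _ = ℤ.- (∑[ z ∈ F ] μ-below x y rec z)
  ... | no  _ | no  _ = 0ℤ

  μ-below x y rec z with x ≤? z | z <? y
  ... | yes _ | yes z<y = μ-acc x z (rec z<y)
  ... | yes _ | no  _   = 0ℤ
  ... | no  _ | _       = 0ℤ

  μ : Carrier → Carrier → ℤ
  μ x y = μ-acc x y (<-wf y)

-- Loops and multiple edges are allowed.

record Graph (n : ℕ) : Set where
  field
    #edges : ℕ
    ends   : Fin #edges → Fin n × Fin n

Adjacent : Graph n → Rel (Fin n) 0ℓ
Adjacent Γ u v = ∃[ e ] (ends e ≡ (u , v) ⊎ ends e ≡ (v , u))
  where open Graph Γ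

adjacent? : (Γ : Graph n) → B.Decidable (Adjacent Γ)
adjacent? Γ u v = any? λ e → (ends e ≟² (u , v)) ⊎-dec (ends e ≟² (v , u))
  where
  open Graph Γ
  _≟²_ = ×-≡-dec _≟ᶠ_ _≟ᶠ_

AdjacentIn : Graph n → Subset n → Rel (Fin n) 0ℓ
AdjacentIn Γ W u v = u ∈ W × v ∈ W × Adjacent Γ u v

-- Connectedness of the subgraph of Γ induced by W, for nonempty W.

InducesConnected : Graph n → Subset n → Set
InducesConnected Γ W = ∀ u v → u ∈ W → v ∈ W → Star (AdjacentIn Γ W) u v

-- Reachability on Fin (suc n) is decided by shortcutting all paths through
-- the vertex zero.

private
  Bypass : Rel (Fin (suc n)) 0ℓ → Rel (Fin n) 0ℓ
  Bypass R i j = R (suc i) (suc j) ⊎ (R (suc i) zero × R zero (suc j))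

  module _ {R : Rel (Fin (suc n)) 0ℓ} where

    unbypass : ∀ {i j} → Star (Bypass R) i j → Star R (suc i) (suc j)
    unbypass ε                      = ε
    unbypass (inj₁ r        ◅ rest) = r ◅ unbypass rest
    unbypass (inj₂ (r , r′) ◅ rest) = r ◅ r′ ◅ unbypass rest

    Bypass⁺ : Rel (Fin (suc n)) 0ℓ
    Bypass⁺ zero    zero    = ⊤
    Bypass⁺ zero    (suc j) = ∃[ k ] (R zero (suc k) × Star (Bypass R) k j)
    Bypass⁺ (suc i) zero    = ∃[ k ] (Star (Bypass R) i k × R (suc k) zero)
    Bypass⁺ (suc i) (suc j) = Star (Bypass R) i j
      ⊎ (∃[ k ] ∃[ l ] (Star (Bypass R) i k × R (suc k) zero × R zero (suc l) × Star (Bypass R) l j))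

    bypass : ∀ i j → Star R i j → Bypass⁺ i j
    bypass zero zero p = tt
    bypass zero (suc j) (_◅_ {j = zero}  r rest) = bypass zero (suc j) rest
    bypass zero (suc j) (_◅_ {j = suc k} r rest) with bypass (suc k) (suc j) rest
    ... | inj₁ p                       = k , r , p
    ... | inj₂ (_ , l , _ , _ , r′ , p) = l , r′ , p
    bypass (suc i) zero (_◅_ {j = zero}  r rest) = i , ε , r
    bypass (suc i) zero (_◅_ {j = suc k} r rest) with bypass (suc k) zero rest
    ... | l , p , r′ = l , inj₁ r ◅ p , r′
    bypass (suc i) (suc j) ε = inj₁ ε
    bypass (suc i) (suc j) (_◅_ {j = zero}  r rest) with bypass zero (suc j) rest
    ... | k , r′ , p = inj₁ (inj₂ (r , r′) ◅ p)
    bypass (suc i) (suc j) (_◅_ {j = suc k} r rest) with bypass (suc k) (suc j) rest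
    ... | inj₁ p                    = inj₁ (inj₁ r ◅ p)
    ... | inj₂ (l , l′ , p , rest′) = inj₂ (l , l′ , inj₁ r ◅ p , rest′)

star? : {R : Rel (Fin n) 0ℓ} → B.Decidable R → B.Decidable (Star R)
star? {suc n} {R} R? = go
  where
  bypass? : B.Decidable (Star (Bypass R))
  bypass? = star? λ i j → R? (suc i) (suc j) ⊎-dec (R? (suc i) zero ×-dec R? zero (suc j))

  go : B.Decidable (Star R)
  go zero zero = yes ε
  go zero (suc j) = map′ (λ (_ , r , p) → r ◅ unbypass p) (bypass zero (suc j))
    (any? λ k → R? zero (suc k) ×-dec bypass? k j)
  go (suc i) zero = map′ (λ (_ , p , r) → unbypass p ◅◅ r ◅ ε) (bypass (suc i) zero)
    (any? λ k → bypass? i k ×-dec R? (suc k) zero)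
  go (suc i) (suc j) = map′
    (λ { (inj₁ p) → unbypass p
       ; (inj₂ (_ , _ , p , r , r′ , q)) → unbypass p ◅◅ r ◅ r′ ◅ unbypass q })
    (bypass (suc i) (suc j))
    (bypass? i j ⊎-dec any? λ k → any? λ l →
      bypass? i k ×-dec R? (suc k) zero ×-dec R? zero (suc l) ×-dec bypass? l j)

inducesConnected? : (Γ : Graph n) → Decidable (InducesConnected Γ)
inducesConnected? Γ W = all? λ u → all? λ v → (u ∈? W) →-dec ((v ∈? W) →-dec
  star? (λ a b → (a ∈? W) ×-dec (b ∈? W) ×-dec adjacent? Γ a b) u v)

record IsColouring (Γ : Graph n) (h : Fin n → ℤ) (m : ℤ) (x : Fin n → ℤ) : Set where
  field
    inRange : ∀ v → (h v ℤ.< x v) × (x v ℤ.≤ m)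
    -- Only distinct endpoints are constrained, so loops have no effect.
    proper  : ∀ u v → u ≢ v → Adjacent Γ u v → x u ≢ x v

isColouring? : (Γ : Graph n) (h : Fin n → ℤ) (m : ℤ) → Decidable (IsColouring Γ h m)
isColouring? Γ h m x = map′
  (λ (r , p) → record { inRange = r ; proper = p })
  (λ c → IsColouring.inRange c , IsColouring.proper c)
  ((all? λ v → (h v ℤ.<? x v) ×-dec (x v ℤ.≤? m)) ×-dec
   (all? λ u → all? λ v → ¬? (u ≟ᶠ v) →-dec (adjacent? Γ u v →-dec ¬? (x u ℤ.≟ x v))))

ColouringSetoid : Graph n → (Fin n → ℤ) → ℤ → Setoid 0ℓ 0ℓ
ColouringSetoid {n} Γ h m = On.setoid {B = ∃ (IsColouring Γ h m)} (Fin n →-setoid ℤ) proj₁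

infix 8 _⁺
_⁺ : ℤ → ℤ
r ⁺ = r ⊔ 0ℤ

-- The half-open interval (l , m].
interval : ℤ → ℤ → List ℤ
interval l m = map (λ k → ℤ.suc l ℤ.+ + k) (upTo ℤ.∣ (m ℤ.- l) ⁺ ∣)

interval-complete : ∀ {l m a} → l ℤ.< a → a ℤ.≤ m → a L.∈ interval l m
interval-complete {l} {m} {a} l<a a≤m = subst (L._∈ interval l m) shift
  (L.∈-map⁺ (λ k → ℤ.suc l ℤ.+ + k) (L.∈-upTo⁺ (ℤ.drop‿+<+ bound)))
  where
  k = ℤ.∣ a ℤ.- ℤ.suc l ∣

  k≡ : + k ≡ a ℤ.- ℤ.suc l
  k≡ = ℤ.0≤i⇒+∣i∣≡i (ℤ.i≤j⇒0≤j-i (ℤ.i<j⇒suc[i]≤j l<a))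

  shift : ℤ.suc l ℤ.+ + k ≡ a
  shift = trans (cong (λ t → ℤ.suc l ℤ.+ t) k≡)
    (trans (ℤ.+-comm (ℤ.suc l) _) (trans (ℤ.+-assoc a _ _)
    (trans (cong (λ t → a ℤ.+ t) (ℤ.+-inverseˡ (ℤ.suc l))) (ℤ.+-identityʳ a))))

  bound : + k ℤ.< + ℤ.∣ (m ℤ.- l) ⁺ ∣
  bound = begin-strict
    + k                   ≡⟨ k≡ ⟩
    a ℤ.- ℤ.suc l         <⟨ ℤ.+-mono-≤-< a≤m (ℤ.neg-mono-< (ℤ.suc[i]≤j⇒i<j ℤ.≤-refl)) ⟩
    m ℤ.- l               ≤⟨ ℤ.i≤i⊔j (m ℤ.- l) 0ℤ ⟩
    (m ℤ.- l) ⁺           ≡⟨ ℤ.0≤i⇒+∣i∣≡i (ℤ.i≤j⊔i (m ℤ.- l) 0ℤ) ⟨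
    + ℤ.∣ (m ℤ.- l) ⁺ ∣   ∎
    where open ℤ.≤-Reasoning

interval-unique : ∀ l m → ≡-Unique.Unique (interval l m)
interval-unique l m = ≡-Unique.map⁺
  (λ eq → ℤ.+-injective (∙-cancelˡ (ℤ.suc l) _ _ eq)) (≡-Unique.upTo⁺ _)

choices : ∀ {n} → (Fin n → List A) → List (Fin n → A)
choices {n = zero}  ls = F.[] ∷ []
choices {n = suc n} ls = cartesianProductWith F._∷_ (ls zero) (choices (ls ∘ suc))

choices-complete : ∀ {n} (ls : Fin n → List A) x → (∀ i → x i L.∈ ls i) →
                   ∃[ y ] y L.∈ choices ls × x ≗ y
choices-complete {n = zero}  ls x x∈ = F.[] , here refl , λ ()
choices-complete {n = suc n} ls x x∈ =
  let (y , y∈ , x≗y) = choices-complete (ls ∘ suc) (x ∘ suc) (x∈ ∘ suc) in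
  x zero F.∷ y , L.∈-cartesianProductWith⁺ F._∷_ (x∈ zero) y∈ ,
  λ { zero → refl ; (suc i) → x≗y i }

choices-unique : ∀ {n} (ls : Fin n → List A) → (∀ i → ≡-Unique.Unique (ls i)) →
                 Unique (Fin n →-setoid A) (choices ls)
choices-unique {n = zero}  ls u = [] ∷ []
choices-unique {A} {n = suc n} ls u = Unique.cartesianProductWith⁺
  (setoid A) (Fin n →-setoid A) (Fin (suc n) →-setoid A) F._∷_
  (λ eq → eq zero , eq ∘ suc) (u zero) (choices-unique (ls ∘ suc) (u ∘ suc))

IsColouring-resp : ∀ {Γ : Graph n} {h m x y} → x ≗ y → IsColouring Γ h m x → IsColouring Γ h m y
IsColouring-resp {h = h} {m} x≗y c = record
  { inRange = λ v → subst (h v ℤ.<_) (x≗y v) (proj₁ (inRange v)) ,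
                    subst (ℤ._≤ m) (x≗y v) (proj₂ (inRange v))
  ; proper  = λ u v u≢v uv yu≡yv → proper u v u≢v uv (trans (x≗y u) (trans yu≡yv (sym (x≗y v))))
  }
  where open IsColouring c

colourings : (Γ : Graph n) (h : Fin n → ℤ) (m : ℤ) → Finite (ColouringSetoid Γ h m)
colourings {n} Γ h m = finiteSubset (Fin n →-setoid ℤ) (isColouring? Γ h m)
  (choices (λ v → interval (h v) m))
  (choices-unique _ (λ v → interval-unique (h v) m))
  λ x c → let (y , y∈ , x≗y) = choices-complete (λ v → interval (h v) m) x
                (λ v → let (l , u) = IsColouring.inRange c v in interval-complete l u)
          in y , y∈ , IsColouring-resp x≗y c , x≗y

χ : Graph n → (Fin n → ℤ) → ℤ → ℕ
χ Γ h m = card (colourings Γ h m)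

Disjoint : Rel (Subset n) 0ℓ
Disjoint V W = Empty (V ∩ W)

-- The blocks are listed without repetition, since they are nonempty and
-- pairwise disjoint.

record IsConnectedPartition (Γ : Graph n) (blocks : List (Subset n)) : Set where
  field
    nonempty  : All Nonempty blocks
    disjoint  : AllPairs Disjoint blocks
    covering  : ∀ v → Any (v ∈_) blocks
    connected : All (InducesConnected Γ) blocks

ConnectedPartition : Graph n → Set
ConnectedPartition Γ = ∃ (IsConnectedPartition Γ)

blocks : {Γ : Graph n} → ConnectedPartition Γ → List (Subset n)
blocks = proj₁

-- The order of the list of blocks is immaterial: partitions are equal when
-- they have the same blocks.

_≈ᵇ_ : Rel (List (Subset n)) 0ℓ
bs ≈ᵇ cs = (∀ {W} → W L.∈ bs → W L.∈ cs) × (∀ {W} → W L.∈ cs → W L.∈ bs)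

BlocksSetoid : ℕ → Setoid 0ℓ 0ℓ
BlocksSetoid n = record
  { Carrier       = List (Subset n)
  ; _≈_           = _≈ᵇ_
  ; isEquivalence = record
    { refl  = id , id
    ; sym   = λ (f , g) → g , f
    ; trans = λ (f , g) (f′ , g′) → (λ w → f′ (f w)) , (λ w → g (g′ w))
    }
  }

module _ (Γ : Graph n) where

  infix 4 _≈_ _≤_

  _≈_ : Rel (ConnectedPartition Γ) 0ℓ
  π ≈ σ = blocks π ≈ᵇ blocks σ

  _≤_ : Rel (ConnectedPartition Γ) 0ℓ
  π ≤ σ = All (λ V → Any (V ⊆_) (blocks σ)) (blocks π)

  ≤-reflexive : ∀ {π σ} → π ≈ σ → π ≤ σ
  ≤-reflexive (π⊆σ , _) = All.tabulate λ V∈π → Any.map (λ { refl v∈V → v∈V }) (π⊆σ V∈π)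

  ≤-trans : ∀ {π σ τ} → π ≤ σ → σ ≤ τ → π ≤ τ
  ≤-trans {π} {σ} {τ} π≤σ σ≤τ = All.map step π≤σ
    where
    step : ∀ {V} → Any (V ⊆_) (blocks σ) → Any (V ⊆_) (blocks τ)
    step {V} V⊆ = let (W , W∈σ , V⊆W) = L.find V⊆ in
      Any.map {P = W ⊆_} {Q = V ⊆_} (λ W⊆X v∈V → W⊆X (V⊆W v∈V)) (All.lookup σ≤τ W∈σ)

  same-block : (π : ConnectedPartition Γ) → ∀ {v V W} →
               V L.∈ blocks π → W L.∈ blocks π → v ∈ V → v ∈ W → V ≡ W
  same-block (_ , p) V∈ W∈ v∈V v∈W = go (IsConnectedPartition.disjoint p) V∈ W∈
    where
    go : ∀ {bs} → AllPairs Disjoint bs → _ L.∈ bs → _ L.∈ bs → _ ≡ _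
    go (_ ∷ _)  (here refl) (here refl) = refl
    go (d ∷ _)  (here refl) (there W∈)  = contradiction (_ , x∈p∩q⁺ (v∈V , v∈W)) (All.lookup d W∈)
    go (d ∷ _)  (there V∈)  (here refl) = contradiction (_ , x∈p∩q⁺ (v∈W , v∈V)) (All.lookup d V∈)
    go (_ ∷ ds) (there V∈)  (there W∈)  = go ds V∈ W∈

  ≤-antisym : ∀ {π σ} → π ≤ σ → σ ≤ π → π ≈ σ
  ≤-antisym {π} {σ} π≤σ σ≤π = half π σ π≤σ σ≤π , half σ π σ≤π π≤σ
    where
    half : ∀ π σ → π ≤ σ → σ ≤ π → ∀ {V} → V L.∈ blocks π → V L.∈ blocks σ
    half π σ π≤σ σ≤π V∈π =
      let (W , W∈σ , V⊆W) = L.find (All.lookup π≤σ V∈π)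
          (X , X∈π , W⊆X) = L.find (All.lookup σ≤π W∈σ)
          (v , v∈V)       = All.lookup (IsConnectedPartition.nonempty (proj₂ π)) V∈π
          V≡X             = same-block π V∈π X∈π v∈V (W⊆X (V⊆W v∈V))
          W≡V             = ⊆-antisym (λ w∈W → subst (_ ∈_) (sym V≡X) (W⊆X w∈W)) V⊆W
      in subst (L._∈ blocks σ) W≡V W∈σ

  _≤?_ : B.Decidable _≤_
  π ≤? σ = All.all? (λ V → Any.any? (V ⊆?_) (blocks σ)) (blocks π)

  Π-poset : DecPoset 0ℓ 0ℓ 0ℓ
  Π-poset = record
    { Carrier           = ConnectedPartition Γ
    ; _≈_               = _≈_
    ; _≤_               = _≤_
    ; isDecPartialOrder = record
      { isPartialOrder = record
        { isPreorder = record
          { isEquivalence = On.isEquivalence proj₁ (Setoid.isEquivalence (BlocksSetoid n))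
          ; reflexive     = λ {π} {σ} → ≤-reflexive {π} {σ}
          ; trans         = λ {π} {σ} {τ} → ≤-trans {π} {σ} {τ}
          }
        ; antisym    = λ {π} {σ} → ≤-antisym {π} {σ}
        }
      ; _≟_  = λ π σ → map′ (λ (p , q) → ≤-antisym {π} {σ} p q)
                 (λ eq → ≤-reflexive {π} {σ} eq , ≤-reflexive {σ} {π} (proj₂ eq , proj₁ eq))
                 ((π ≤? σ) ×-dec (σ ≤? π))
      ; _≤?_ = _≤?_
      }
    }

isConnectedPartition? : (Γ : Graph n) → Decidable (IsConnectedPartition Γ)
isConnectedPartition? Γ bs = map′
  (λ (ne , d , cov , con) →
    record { nonempty = ne ; disjoint = d ; covering = cov ; connected = con })
  (λ p → let open IsConnectedPartition p in nonempty , disjoint , covering , connected)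
  (All.all? nonempty? bs ×-dec
   AllPairs.allPairs? (λ V W → ¬? (nonempty? (V ∩ W))) bs ×-dec
   (all? λ v → Any.any? (v ∈?_) bs) ×-dec
   All.all? (inducesConnected? Γ) bs)

subsets : ∀ n → List (Subset n)
subsets zero    = [] ∷ []
subsets (suc n) = cartesianProductWith _∷_ (inside ∷ outside ∷ []) (subsets n)

∈-subsets : (W : Subset n) → W L.∈ subsets n
∈-subsets []            = here refl
∈-subsets (inside  ∷ W) =
  L.∈-cartesianProductWith⁺ _∷_ {xs = inside ∷ outside ∷ []} (here refl) (∈-subsets W)
∈-subsets (outside ∷ W) =
  L.∈-cartesianProductWith⁺ _∷_ {xs = inside ∷ outside ∷ []} (there (here refl)) (∈-subsets W)

subsets-unique : ∀ n → ≡-Unique.Unique (subsets n)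
subsets-unique zero    = [] ∷ []
subsets-unique (suc n) = ≡-Unique.cartesianProductWith⁺ _∷_ Vec.∷-injective
  (((λ ()) ∷ []) ∷ [] ∷ []) (subsets-unique n)

sublists : List A → List (List A)
sublists []       = [] ∷ []
sublists (x ∷ xs) = map (x ∷_) (sublists xs) ++ sublists xs

filter∈sublists : {P : Pred A 0ℓ} (P? : Decidable P) → ∀ xs → filter P? xs L.∈ sublists xs
filter∈sublists P? [] = here refl
filter∈sublists P? (x ∷ xs) with P? x
... | yes _ = L.∈-++⁺ˡ (L.∈-map⁺ (x ∷_) (filter∈sublists P? xs))
... | no  _ = L.∈-++⁺ʳ (map (x ∷_) (sublists xs)) (filter∈sublists P? xs)

∈-sublists⁻ : ∀ {x : A} xs {ys} → ys L.∈ sublists xs → x L.∈ ys → x L.∈ xs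
∈-sublists⁻ [] (here refl) ()
∈-sublists⁻ (x ∷ xs) ys∈ z∈ with L.∈-++⁻ (map (x ∷_) (sublists xs)) ys∈
... | inj₂ ys∈′ = there (∈-sublists⁻ xs ys∈′ z∈)
... | inj₁ ys∈′ with L.∈-map⁻ (x ∷_) ys∈′
...   | (_ , zs∈ , refl) with z∈
...     | here eq   = here eq
...     | there z∈′ = there (∈-sublists⁻ xs zs∈ z∈′)

sublists-unique : {bs : List (Subset n)} → ≡-Unique.Unique bs →
                  Unique (BlocksSetoid n) (sublists bs)
sublists-unique [] = [] ∷ []
sublists-unique {n} {x ∷ xs} (x∉ ∷ u) = AllPairs.++⁺
  (AllPairs.map⁺ (extend (All.tabulate id) (sublists-unique u)))
  (sublists-unique u)
  (All.map⁺ (All.tabulate λ _ → All.tabulate λ cs∈ (f , _) →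
    x∉xs (∈-sublists⁻ xs cs∈ (f (here refl)))))
  where
  x∉xs : ¬ x L.∈ xs
  x∉xs x∈ = All.lookup x∉ x∈ refl

  strip : ∀ {bs cs} → bs L.∈ sublists xs → (∀ {W} → W L.∈ x ∷ bs → W L.∈ x ∷ cs) →
          ∀ {W} → W L.∈ bs → W L.∈ cs
  strip bs∈ f W∈ with f (there W∈)
  ... | here refl = contradiction (∈-sublists⁻ xs bs∈ W∈) x∉xs
  ... | there W∈′ = W∈′

  extend : ∀ {bss} → All (L._∈ sublists xs) bss → Unique (BlocksSetoid n) bss →
           AllPairs (λ bs cs → ¬ (x ∷ bs) ≈ᵇ (x ∷ cs)) bss
  extend [] [] = []
  extend (bs∈ ∷ bss∈) (bs∉ ∷ u) =
    All.zipWith (λ (cs∈ , ≉) (f , g) → ≉ (strip bs∈ f , strip cs∈ g)) (bss∈ , bs∉) ∷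
    extend bss∈ u

Π : (Γ : Graph n) → Finite (DecPoset.Eq.setoid (Π-poset Γ))
Π {n} Γ = finiteSubset (BlocksSetoid n) (isConnectedPartition? Γ)
  (sublists (subsets n)) (sublists-unique (subsets-unique n)) canonical
  where
  canonical : ∀ bs → IsConnectedPartition Γ bs →
              ∃[ cs ] cs L.∈ sublists (subsets n) × IsConnectedPartition Γ cs × bs ≈ᵇ cs
  canonical bs p = cs , filter∈sublists _∈bs? (subsets n) , p′ , (to , from)
    where
    open IsConnectedPartition p
    _∈bs? = λ W → mem? (Vec.≡-dec _≟ᵇ_) W bs
    cs = filter _∈bs? (subsets n)

    to : ∀ {W} → W L.∈ bs → W L.∈ cs
    to {W} W∈ = L.∈-filter⁺ _∈bs? (∈-subsets W) W∈

    from : ∀ {W} → W L.∈ cs → W L.∈ bs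
    from W∈ = proj₂ (L.∈-filter⁻ _∈bs? {xs = subsets n} W∈)

    apart : ∀ {ds} → All (L._∈ bs) ds → ≡-Unique.Unique ds → AllPairs Disjoint ds
    apart [] [] = []
    apart (V∈ ∷ ds∈) (V∉ ∷ u) =
      All.zipWith (λ (W∈ , V≢W) (v , v∈) → let (v∈V , v∈W) = x∈p∩q⁻ _ _ v∈ in
        V≢W (same-block Γ (bs , p) V∈ W∈ v∈V v∈W)) (ds∈ , V∉) ∷
      apart ds∈ u

    p′ : IsConnectedPartition Γ cs
    p′ = record
      { nonempty  = All.tabulate λ W∈ → All.lookup nonempty (from W∈)
      ; disjoint  = apart (All.tabulate from) (AllPairs.filter⁺ _∈bs? (subsets-unique n))
      ; covering  = λ v → let (_ , W∈ , v∈W) = L.find (covering v) in L.lose (to W∈) v∈W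
      ; connected = All.tabulate λ W∈ → All.lookup connected (from W∈)
      }

0̂ : {Γ : Graph n} → ConnectedPartition Γ
0̂ {n} {Γ} = map ⁅_⁆ (allFin n) , record
  { nonempty  = All.map⁺ (All.tabulate λ {v} _ → v , x∈⁅x⁆ v)
  ; disjoint  = AllPairs.map⁺ (AllPairs.map
      (λ u≢v (_ , w∈) → let (w∈u , w∈v) = x∈p∩q⁻ _ _ w∈ in
        u≢v (trans (sym (x∈⁅y⁆⇒x≡y _ w∈u)) (x∈⁅y⁆⇒x≡y _ w∈v)))
      (≡-Unique.allFin⁺ n))
  ; covering  = λ v → Any.map⁺ (L.lose (L.∈-allFin v) (x∈⁅x⁆ v))
  ; connected = All.map⁺ (All.tabulate λ {w} _ u v u∈ v∈ →
      subst (Star _ u) (trans (x∈⁅y⁆⇒x≡y w u∈) (sym (x∈⁅y⁆⇒x≡y w v∈))) ε)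
  }

0̂-least : {Γ : Graph n} (π : ConnectedPartition Γ) → _≤_ Γ 0̂ π
0̂-least (_ , p) = All.map⁺ (All.tabulate λ {v} _ →
  Any.map {Q = ⁅ v ⁆ ⊆_} (λ {W} v∈W u∈ → subst (_∈ W) (sym (x∈⁅y⁆⇒x≡y v u∈)) v∈W)
          (IsConnectedPartition.covering p v))

μ : {Γ : Graph n} → ConnectedPartition Γ → ConnectedPartition Γ → ℤ
μ {Γ = Γ} = Möbius.μ (Π-poset Γ) (Π Γ)

-- The initial value of the maximum is h w for some w ∈ W, so the result is
-- max {h v : v ∈ W}.

maxOn : (h : Fin n → ℤ) (W : Subset n) → Nonempty W → ℤ
maxOn {n} h W (w , _) = Extrema.max (h w) (map h (filter (_∈? W) (allFin n)))

∏-blocks : {Γ : Graph n} (π : ConnectedPartition Γ) → ((W : Subset n) → Nonempty W → ℤ) → ℤ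
∏-blocks (_ , p) f =
  foldr ℤ._*_ 1ℤ (All.reduce (λ {W} W≢∅ → f W W≢∅) (IsConnectedPartition.nonempty p))

{-# OPTIONS --safe #-}

-- For x in the box ∏ᵥ (h v , m], let π(x) be the partition of V into the
-- connected components of the subgraph of edges on which x is constant. As the
-- blocks of π ∈ Π(Γ) are connected, x is constant on each of them exactly when
-- π ≤ π(x), and the number of such x is ∏_W [m - h(W)]⁺. Exchanging summations,
-- the right-hand side is the sum over x of ∑_{π ≤ π(x)} μ(0̂,π), which is 1 if
-- π(x) = 0̂, that is, if x is a proper colouring, and 0 otherwise.
module Submission where

open import Defs
open import Data.Bool.Base using (true)
open import Data.Bool.Properties using () renaming (_≟_ to _≟ᵇ_)
open import Data.Fin.Base using (Fin; zero; suc)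
open import Data.Fin.Properties using (all?; any?; injective⇒≤; _≟_)
open import Data.Fin.Subset using (Subset; _∈_; _⊆_; Nonempty; ⁅_⁆)
open import Data.Fin.Subset.Properties using (_∈?_; x∈⁅x⁆; x∈⁅y⁆⇒x≡y; x∈p∩q⁺; x∈p∩q⁻; ⊆-antisym)
open import Data.Integer.Base as ℤ using (ℤ; +_; _*_; _-_; _+_; -_; 0ℤ; 1ℤ)
import Data.Integer.Properties as ℤ
open import Algebra.Properties.CommutativeSemigroup ℤ.+-commutativeSemigroup using (interchange)
open import Data.List.Base
  using (List; []; _∷_; map; foldr; filter; length; lookup; cartesianProductWith; allFin; upTo)
open import Data.List.Properties using (length-map; length-++; length-upTo)
import Data.List.Extrema ℤ.≤-totalOrder as Extrema
import Data.List.Membership.Propositional as L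
import Data.List.Membership.Propositional.Properties as L
open import Data.List.Relation.Unary.All as All using (All; []; _∷_)
import Data.List.Relation.Unary.All.Properties as All
open import Data.List.Relation.Unary.AllPairs using (AllPairs; []; _∷_)
open import Data.List.Relation.Unary.Any as Any using (Any; here; there)
import Data.List.Relation.Unary.Any.Properties as Any
open import Data.List.Relation.Unary.Unique.Setoid using (Unique)
import Data.List.Relation.Unary.Unique.Propositional.Properties as ≡-Unique
import Data.List.Relation.Unary.Unique.Setoid.Properties as Unique
open import Data.Nat.Base as ℕ using (ℕ; zero; suc)
import Data.Nat.Properties as ℕ
open import Data.Product.Base using (∃-syntax; _×_; _,_; proj₁; proj₂)
open import Data.Sum.Base as Sum using (_⊎_; inj₁; inj₂; [_,_]′)
import Data.Vec.Base as Vec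
import Data.Vec.Properties as Vec
open import Function.Base using (_∘_; id)
open import Induction.WellFounded using (Acc; acc)
open import Level using (0ℓ)
open import Relation.Binary.Bundles using (Setoid; DecPoset)
open import Relation.Binary.Core using (Rel)
import Relation.Binary.Definitions as B
import Relation.Binary.Construct.NonStrictToStrict as ToStrict
open import Relation.Binary.Construct.Closure.ReflexiveTransitive as Star using (Star; ε; _◅_; _◅◅_)
open import Relation.Binary.PropositionalEquality
  using (_≡_; _≢_; _≗_; refl; sym; trans; cong; cong₂; subst; subst₂; _→-setoid_; setoid;
         module ≡-Reasoning)
open import Relation.Nullary.Decidable using (Dec; yes; no; does; _×-dec_; dec-true; map′)
open import Relation.Nullary.Negation using (¬_; contradiction)
open import Relation.Unary using (Pred; Decidable)

private variable
  n : ℕ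
  A C P Q : Set

-- Indicators and finite sums

𝟙 : Dec P → ℤ
𝟙 (yes _) = 1ℤ
𝟙 (no  _) = 0ℤ

𝟙-yes : (d : Dec P) → P → 𝟙 d ≡ 1ℤ
𝟙-yes (yes _) p = refl
𝟙-yes (no ¬p) p = contradiction p ¬p

𝟙-no : (d : Dec P) → ¬ P → 𝟙 d ≡ 0ℤ
𝟙-no (yes p) ¬p = contradiction p ¬p
𝟙-no (no _)  ¬p = refl

𝟙-cong : (d : Dec P) (e : Dec Q) → (P → Q) → (Q → P) → 𝟙 d ≡ 𝟙 e
𝟙-cong (yes p) e f g = sym (𝟙-yes e (f p))
𝟙-cong (no ¬p) e f g = sym (𝟙-no e (¬p ∘ g))

∑ : List A → (A → ℤ) → ℤ
∑ xs f = foldr _+_ 0ℤ (map f xs)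

∑-cong : (xs : List A) {f g : A → ℤ} → f ≗ g → ∑ xs f ≡ ∑ xs g
∑-cong []       f≗g = refl
∑-cong (x ∷ xs) f≗g = cong₂ _+_ (f≗g x) (∑-cong xs f≗g)

∑-zero : (xs : List A) {f : A → ℤ} → (∀ x → f x ≡ 0ℤ) → ∑ xs f ≡ 0ℤ
∑-zero []       f≗0 = refl
∑-zero (x ∷ xs) f≗0 = cong₂ _+_ (f≗0 x) (∑-zero xs f≗0)

∑-+ : (xs : List A) (f g : A → ℤ) → ∑ xs (λ x → f x + g x) ≡ ∑ xs f + ∑ xs g
∑-+ []       f g = refl
∑-+ (x ∷ xs) f g = trans (cong (λ s → f x + g x + s) (∑-+ xs f g)) (interchange (f x) (g x) _ _)

∑-*ˡ : (xs : List A) (c : ℤ) (f : A → ℤ) → ∑ xs (λ x → c * f x) ≡ c * ∑ xs f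
∑-*ˡ []       c f = sym (ℤ.*-zeroʳ c)
∑-*ˡ (x ∷ xs) c f = trans (cong (λ s → c * f x + s) (∑-*ˡ xs c f)) (sym (ℤ.*-distribˡ-+ c (f x) _))

∑-swap : (xs : List A) (ys : List C) (f : A → C → ℤ) →
         ∑ xs (λ x → ∑ ys (f x)) ≡ ∑ ys (λ y → ∑ xs (λ x → f x y))
∑-swap []       ys f = sym (∑-zero ys λ _ → refl)
∑-swap (x ∷ xs) ys f = trans (cong (λ s → ∑ ys (f x) + s) (∑-swap xs ys f)) (sym (∑-+ ys (f x) _))

module _ {P : Pred A 0ℓ} (P? : Decidable P) where

  length-satisfying : ∀ xs → + length (satisfying P? xs) ≡ ∑ xs (𝟙 ∘ P?)
  length-satisfying [] = refl
  length-satisfying (x ∷ xs) with P? x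
  ... | yes _ = cong (λ s → 1ℤ + s) (length-satisfying xs)
  ... | no  _ = trans (length-satisfying xs) (sym (ℤ.+-identityˡ _))

  length-filter : ∀ xs → + length (filter P? xs) ≡ ∑ xs (𝟙 ∘ P?)
  length-filter [] = refl
  length-filter (x ∷ xs) with P? x
  ... | yes _ = cong (λ s → 1ℤ + s) (length-filter xs)
  ... | no  _ = trans (length-filter xs) (sym (ℤ.+-identityˡ _))

-- The Möbius function of a finite poset

module _ (P : DecPoset 0ℓ 0ℓ 0ℓ) (F : Finite (DecPoset.Eq.setoid P)) where
  open DecPoset P using (Carrier; antisym; reflexive; ≤-respʳ-≈; ≤-respˡ-≈; module Eq)
    renaming (_≈_ to _≃_; _≤_ to _≼_; _≤?_ to _≼?_; _≟_ to _≟ᴾ_)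
  open ToStrict _≃_ _≼_ using () renaming (_<_ to _≺_)
  open Möbius P F using (μ-acc; μ-below; <-wf) renaming (μ to μᴾ; _<?_ to _≺?_)

  -- The list of elements meets the class of `y` exactly once, so a single summand survives. Its
  -- index is only equivalent to `y`, hence the condition that `f` respects this equivalence.
  ∑-𝟙-≟ : ∀ y (f : Carrier → ℤ) → (∀ {z} → z ≃ y → f z ≡ f y) →
          ∑[ z ∈ F ] (f z * 𝟙 (z ≟ᴾ y)) ≡ f y
  ∑-𝟙-≟ y f f-resp = go (Finite.unique F) (Finite.complete F y)
    where
    open ≡-Reasoning
    go : ∀ {zs} → Unique Eq.setoid zs → Any (y ≃_) zs → ∑ zs (λ z → f z * 𝟙 (z ≟ᴾ y)) ≡ f y
    none : ∀ {zs} → All (λ z → ¬ z ≃ y) zs → ∑ zs (λ z → f z * 𝟙 (z ≟ᴾ y)) ≡ 0ℤ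
    none [] = refl
    none {z ∷ _} (z≉y ∷ zs≉y) = cong₂ _+_
      (trans (cong (f z *_) (𝟙-no (z ≟ᴾ y) z≉y)) (ℤ.*-zeroʳ (f z))) (none zs≉y)
    go {z ∷ zs} (z∉ ∷ u) (here y≈z) = begin
      f z * 𝟙 (z ≟ᴾ y) + ∑ zs _ ≡⟨ cong₂ _+_ (cong (f z *_) (𝟙-yes (z ≟ᴾ y) (Eq.sym y≈z)))
                                    (none (All.map (λ z≉w w≈y → z≉w (Eq.sym (Eq.trans w≈y y≈z))) z∉)) ⟩
      f z * 1ℤ + 0ℤ            ≡⟨ ℤ.+-identityʳ _ ⟩
      f z * 1ℤ                 ≡⟨ ℤ.*-identityʳ (f z) ⟩
      f z                      ≡⟨ f-resp (Eq.sym y≈z) ⟩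
      f y                      ∎
    go {z ∷ zs} (z∉ ∷ u) (there y∈) = begin
      f z * 𝟙 (z ≟ᴾ y) + ∑ zs _ ≡⟨ cong₂ _+_ (cong (f z *_) (𝟙-no (z ≟ᴾ y) z≉y)) (go u y∈) ⟩
      f z * 0ℤ + f y           ≡⟨ cong (_+ f y) (ℤ.*-zeroʳ (f z)) ⟩
      0ℤ + f y                 ≡⟨ ℤ.+-identityˡ (f y) ⟩
      f y                      ∎
      where
      z≉y : ¬ z ≃ y
      z≉y z≈y = let (w , w∈ , y≈w) = L.find y∈ in All.lookup z∉ w∈ (Eq.trans z≈y y≈w)

  -- The recursion runs on accessibility proofs. Besides invariance under `≃`, this gives
  -- independence of the proof: take `y` and `y′` equal.
  μ-acc-cong : ∀ {x y y′} (a : Acc _≺_ y) (a′ : Acc _≺_ y′) → y ≃ y′ → μ-acc x y a ≡ μ-acc x y′ a′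
  μ-below-cong : ∀ {x y y′} (r : ∀ {z} → z ≺ y → Acc _≺_ z) (r′ : ∀ {z} → z ≺ y′ → Acc _≺_ z) →
                 y ≃ y′ → ∀ z → μ-below x y r z ≡ μ-below x y′ r′ z

  μ-acc-cong {x} {y} {y′} (acc r) (acc r′) y≈y′ with x ≟ᴾ y | x ≟ᴾ y′ | x ≼? y | x ≼? y′
  ... | yes _   | yes _    | _      | _        = refl
  ... | yes x≈y | no x≉y′  | _      | _        = contradiction (Eq.trans x≈y y≈y′) x≉y′
  ... | no x≉y  | yes x≈y′ | _      | _        = contradiction (Eq.trans x≈y′ (Eq.sym y≈y′)) x≉y
  ... | no _    | no _     | yes _   | yes _    = cong -_ (∑-cong (elements F) (μ-below-cong r r′ y≈y′))
  ... | no _    | no _     | yes x≤y | no x≰y′  = contradiction (≤-respʳ-≈ y≈y′ x≤y) x≰y′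
  ... | no _    | no _     | no x≰y  | yes x≤y′ = contradiction (≤-respʳ-≈ (Eq.sym y≈y′) x≤y′) x≰y
  ... | no _    | no _     | no _    | no _     = refl

  μ-below-cong {x} {y} {y′} r r′ y≈y′ z with x ≼? z | z ≺? y | z ≺? y′
  ... | yes _ | yes z<y | yes z<y′ = μ-acc-cong (r z<y) (r′ z<y′) Eq.refl
  ... | yes _ | yes (z≤y , z≉y) | no z≮y′ =
    contradiction (≤-respʳ-≈ y≈y′ z≤y , λ z≈y′ → z≉y (Eq.trans z≈y′ (Eq.sym y≈y′))) z≮y′
  ... | yes _ | no z≮y | yes (z≤y′ , z≉y′) =
    contradiction (≤-respʳ-≈ (Eq.sym y≈y′) z≤y′ , λ z≈y → z≉y′ (Eq.trans z≈y y≈y′)) z≮y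
  ... | yes _ | no _ | no _ = refl
  ... | no _  | _    | _    = refl

  μ-acc-≈ : ∀ {x y} a → x ≃ y → μ-acc x y a ≡ 1ℤ
  μ-acc-≈ {x} {y} (acc _) x≈y with x ≟ᴾ y | x ≼? y
  ... | yes _  | _ = refl
  ... | no x≉y | _ = contradiction x≈y x≉y

  μ-acc-≰ : ∀ {x y} a → ¬ x ≼ y → μ-acc x y a ≡ 0ℤ
  μ-acc-≰ {x} {y} (acc _) x≰y with x ≟ᴾ y | x ≼? y
  ... | yes x≈y | _       = contradiction (reflexive x≈y) x≰y
  ... | no _    | yes x≤y = contradiction x≤y x≰y
  ... | no _    | no _    = refl

  -- The accessibility proof a is arbitrary because x ≼? z can also occur
  -- inside <-wf z, where a with-abstraction would capture them.
  μ-below-≡ : ∀ {x y z} (r : ∀ {z} → z ≺ y → Acc _≺_ z) (a : Acc _≺_ z) →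
              μ-below x y r z ≡ μ-acc x z a * 𝟙 (z ≺? y)
  μ-below-≡ {x} {y} {z} r a with x ≼? z | z ≺? y
  ... | yes _  | yes z<y = trans (μ-acc-cong (r z<y) a Eq.refl) (sym (ℤ.*-identityʳ _))
  ... | yes _  | no _    = sym (ℤ.*-zeroʳ (μ-acc x z a))
  ... | no x≰z | d       = sym (cong (_* 𝟙 d) (μ-acc-≰ a x≰z))

  μ-acc-< : ∀ {x y} a → x ≺ y → μ-acc x y a ≡ - (∑[ z ∈ F ] (μᴾ x z * 𝟙 (z ≺? y)))
  μ-acc-< {x} {y} (acc r) (x≤y , x≉y) with x ≟ᴾ y | x ≼? y
  ... | yes x≈y | _       = contradiction x≈y x≉y
  ... | no _    | no x≰y  = contradiction x≤y x≰y
  ... | no _    | yes _   = cong -_ (∑-cong (elements F) (λ z → μ-below-≡ r (<-wf z)))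

  -- Separate the term `z ≃ y`, which contributes `μᴾ x y`. If `x ≺ y`, the recursion makes it the
  -- negative of the remaining sum; if `x ≃ y`, it is 1 and the remaining sum vanishes.
  ∑-μ : ∀ {x y} → x ≼ y → ∑[ z ∈ F ] (μᴾ x z * 𝟙 (z ≼? y)) ≡ 𝟙 (x ≟ᴾ y)
  ∑-μ {x} {y} x≤y = begin
    ∑[ z ∈ F ] (μᴾ x z * 𝟙 (z ≼? y))
      ≡⟨ ∑-cong (elements F) split ⟩
    ∑[ z ∈ F ] (μᴾ x z * 𝟙 (z ≺? y) + μᴾ x z * 𝟙 (z ≟ᴾ y))
      ≡⟨ ∑-+ (elements F) _ _ ⟩
    below + (∑[ z ∈ F ] (μᴾ x z * 𝟙 (z ≟ᴾ y)))
      ≡⟨ cong (λ s → below + s) (∑-𝟙-≟ y (μᴾ x) λ {z} → μ-acc-cong (<-wf z) (<-wf y)) ⟩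
    below + μᴾ x y
      ≡⟨ last (x ≟ᴾ y) ⟩
    𝟙 (x ≟ᴾ y) ∎
    where
    open ≡-Reasoning
    below = ∑[ z ∈ F ] (μᴾ x z * 𝟙 (z ≺? y))

    𝟙-≤ : ∀ z → (d : Dec (z ≃ y)) → 𝟙 (z ≼? y) ≡ 𝟙 (z ≺? y) + 𝟙 d
    𝟙-≤ z (yes z≈y) = trans (𝟙-yes (z ≼? y) (reflexive z≈y))
      (cong (_+ 1ℤ) (sym (𝟙-no (z ≺? y) λ z<y → proj₂ z<y z≈y)))
    𝟙-≤ z (no z≉y) = trans (𝟙-cong (z ≼? y) (z ≺? y) (_, z≉y) proj₁) (sym (ℤ.+-identityʳ _))

    split : ∀ z → μᴾ x z * 𝟙 (z ≼? y) ≡ μᴾ x z * 𝟙 (z ≺? y) + μᴾ x z * 𝟙 (z ≟ᴾ y)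
    split z = trans (cong (μᴾ x z *_) (𝟙-≤ z (z ≟ᴾ y))) (ℤ.*-distribˡ-+ (μᴾ x z) _ _)

    -- Here `z ≺ y` with `y ≃ x` rules out `x ≼ z`, by antisymmetry.
    vanish : x ≃ y → ∀ z → (d : Dec (z ≺ y)) → μᴾ x z * 𝟙 d ≡ 0ℤ
    vanish x≈y z (no _)            = ℤ.*-zeroʳ (μᴾ x z)
    vanish x≈y z (yes (z≤y , z≉y)) = cong (_* 1ℤ)
      (μ-acc-≰ (<-wf z) λ x≤z → z≉y (antisym z≤y (≤-respˡ-≈ x≈y x≤z)))

    last : (d : Dec (x ≃ y)) → below + μᴾ x y ≡ 𝟙 d
    last (yes x≈y) = cong₂ _+_ (∑-zero (elements F) λ z → vanish x≈y z (z ≺? y)) (μ-acc-≈ (<-wf y) x≈y)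
    last (no x≉y)  = trans (cong (λ s → below + s) (μ-acc-< (<-wf y) (x≤y , x≉y))) (ℤ.+-inverseʳ below)

-- Counting points of boxes

AllPairs-lookup : {R : Rel A 0ℓ} {xs : List A} → B.Symmetric R → AllPairs R xs →
                  ∀ i j → i ≡ j ⊎ R (lookup xs i) (lookup xs j)
AllPairs-lookup R-sym (r ∷ rs) zero    zero    = inj₁ refl
AllPairs-lookup R-sym (r ∷ rs) zero    (suc j) = inj₂ (All.lookup r (L.∈-lookup j))
AllPairs-lookup R-sym (r ∷ rs) (suc i) zero    = inj₂ (R-sym (All.lookup r (L.∈-lookup i)))
AllPairs-lookup R-sym (r ∷ rs) (suc i) (suc j) = Sum.map₁ (cong suc) (AllPairs-lookup R-sym rs i j)

module _ (S T : Setoid 0ℓ 0ℓ) where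
  private
    module S = Setoid S
    module T = Setoid T

  -- Pigeonhole: each position in `xs` goes to the position in `ys` of the image of its entry.
  -- Uniqueness of `xs` and injectivity of `f` on `P` make this map of positions injective.
  length-≤ : {P : Pred S.Carrier 0ℓ} {xs : List S.Carrier} {ys : List T.Carrier} →
             All P xs → Unique S xs → (f : S.Carrier → T.Carrier) →
             (∀ {x y} → P x → P y → f x T.≈ f y → x S.≈ y) →
             (∀ {x} → P x → Any (f x T.≈_) ys) → length xs ℕ.≤ length ys
  length-≤ {xs = xs} {ys} ps u f inj into = injective⇒≤ {f = φ} φ-injective
    where
    p = λ i → All.lookup ps (L.∈-lookup i)
    φ = λ i → Any.index (into (p i))

    φ-injective : ∀ {i j} → φ i ≡ φ j → i ≡ j
    φ-injective {i} {j} φi≡φj =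
      [ id , (λ ≉ → contradiction (inj (p i) (p j) fi≈fj) ≉) ]′
        (AllPairs-lookup (λ ≉ ≈ → ≉ (S.sym ≈)) u i j)
      where
      fi≈fj = T.trans (Any.lookup-index (into (p i)))
        (T.trans (T.reflexive (cong (lookup ys) φi≡φj)) (T.sym (Any.lookup-index (into (p j)))))

length-cartesianProductWith : ∀ {D : Set} (f : A → C → D) xs ys →
  length (cartesianProductWith f xs ys) ≡ length xs ℕ.* length ys
length-cartesianProductWith f []       ys = refl
length-cartesianProductWith f (x ∷ xs) ys = trans (length-++ (map (f x) ys))
  (cong₂ ℕ._+_ (length-map (f x) ys) (length-cartesianProductWith f xs ys))

choices-sound : ∀ {n} (ls : Fin n → List A) {x} → x L.∈ choices ls → ∀ i → x i L.∈ ls i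
choices-sound {n = suc n} ls x∈ i with L.∈-cartesianProductWith⁻ _ (ls zero) (choices (ls ∘ suc)) x∈
choices-sound {n = suc n} ls x∈ zero    | _ , _ , a∈ , y∈ , refl = a∈
choices-sound {n = suc n} ls x∈ (suc i) | _ , _ , a∈ , y∈ , refl = choices-sound (ls ∘ suc) y∈ i

length-interval : ∀ l m → + length (interval l m) ≡ (m - l) ⁺
length-interval l m = trans (cong +_ (trans (length-map _ (upTo k)) (length-upTo k)))
  (ℤ.0≤i⇒+∣i∣≡i (ℤ.i≤j⊔i (m - l) 0ℤ))
  where k = ℤ.∣ (m - l) ⁺ ∣

interval-sound : ∀ {l m a} → a L.∈ interval l m → l ℤ.< a × a ℤ.≤ m
interval-sound {l} {m} {a} a∈ with L.∈-map⁻ _ a∈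
... | k , k∈ , refl = ℤ.suc[i]≤j⇒i<j (ℤ.i≤i+j (ℤ.suc l) (+ k)) , bound
  where
  k< : + k ℤ.< (m - l) ⁺
  k< = subst (+ k ℤ.<_) (ℤ.0≤i⇒+∣i∣≡i (ℤ.i≤j⊔i (m - l) 0ℤ)) (ℤ.+<+ (L.∈-upTo⁻ k∈))

  -- Nothing nonnegative lies below 0, so the existence of `k` forces the truncated difference to be
  -- the difference itself.
  k<m-l : + k ℤ.< m - l
  k<m-l with ℤ.⊔-sel (m - l) 0ℤ
  ... | inj₁ eq = subst (+ k ℤ.<_) eq k<
  ... | inj₂ eq = contradiction (subst (+ k ℤ.<_) eq k<) λ { (ℤ.+<+ ()) }

  bound : ℤ.suc l + + k ℤ.≤ m
  bound = begin
    ℤ.suc l + + k    ≡⟨ cong (_+ + k) (ℤ.+-comm 1ℤ l) ⟩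
    l + 1ℤ + + k     ≡⟨ ℤ.+-assoc l 1ℤ (+ k) ⟩
    l + ℤ.suc (+ k)  ≤⟨ ℤ.+-monoʳ-≤ l (ℤ.i<j⇒suc[i]≤j k<m-l) ⟩
    l + (m - l)      ≡⟨ ℤ.+-comm l (m - l) ⟩
    m - l + l        ≡⟨ ℤ.+-assoc m (- l) l ⟩
    m + (- l + l)    ≡⟨ cong (λ s → m + s) (ℤ.+-inverseˡ l) ⟩
    m + 0ℤ           ≡⟨ ℤ.+-identityʳ m ⟩
    m                ∎
    where open ℤ.≤-Reasoning

InRange : (Fin n → ℤ) → ℤ → Pred (Fin n → ℤ) 0ℓ
InRange h m x = ∀ v → h v ℤ.< x v × x v ℤ.≤ m

inRange? : (h : Fin n → ℤ) (m : ℤ) → Decidable (InRange h m)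
inRange? h m x = all? λ v → (h v ℤ.<? x v) ×-dec (x v ℤ.≤? m)

box : (Fin n → ℤ) → ℤ → List (Fin n → ℤ)
box h m = choices λ v → interval (h v) m

box-unique : (h : Fin n → ℤ) (m : ℤ) → Unique (Fin n →-setoid ℤ) (box h m)
box-unique h m = choices-unique _ λ v → interval-unique (h v) m

-- Functions with the same values need not be propositionally equal, so membership holds up to `≗`
-- only.
box-complete : ∀ {h : Fin n → ℤ} {m x} → InRange h m x → ∃[ y ] y L.∈ box h m × x ≗ y
box-complete {h = h} {m} {x} r = choices-complete (λ v → interval (h v) m) x
  λ v → interval-complete (proj₁ (r v)) (proj₂ (r v))

box-sound : ∀ {h : Fin n → ℤ} {m x} → x L.∈ box h m → InRange h m x
box-sound {h = h} {m} x∈ v = interval-sound (choices-sound (λ v → interval (h v) m) x∈ v)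

-- Maxima over blocks

maxOn-upper : ∀ (h : Fin n → ℤ) {W} (W≢∅ : Nonempty W) {v} → v ∈ W → h v ℤ.≤ maxOn h W W≢∅
maxOn-upper h {W} (w , _) {v} v∈W = All.lookup (Extrema.xs≤max (h w) _)
  (L.∈-map⁺ h (L.∈-filter⁺ (_∈? W) (L.∈-allFin v) v∈W))

maxOn-attained : ∀ (h : Fin n → ℤ) {W} (W≢∅ : Nonempty W) → ∃[ v ] v ∈ W × maxOn h W W≢∅ ≡ h v
maxOn-attained h {W} (w , w∈W) with Extrema.argmax-sel id (h w) (map h (filter (_∈? W) (allFin _)))
... | inj₁ eq = w , w∈W , eq
... | inj₂ ∈hs = let (v , v∈ , eq) = L.∈-map⁻ h ∈hs in
  v , proj₂ (L.∈-filter⁻ (_∈? W) {xs = allFin _} v∈) , eq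

-- A function constant on blocks amounts to one value per block. These are the lower bounds for such
-- values, indexed by block position so that `box` applies to them.
blockMax : (h : Fin n → ℤ) {bs : List (Subset n)} → All Nonempty bs → Fin (length bs) → ℤ
blockMax h (W≢∅ ∷ _)   zero    = maxOn h _ W≢∅
blockMax h (_   ∷ bs≢) (suc i) = blockMax h bs≢ i

blockMax-upper : ∀ (h : Fin n → ℤ) {bs} (bs≢ : All Nonempty bs) i {v} →
                 v ∈ lookup bs i → h v ℤ.≤ blockMax h bs≢ i
blockMax-upper h (W≢∅ ∷ _)   zero    = maxOn-upper h W≢∅
blockMax-upper h (_   ∷ bs≢) (suc i) = blockMax-upper h bs≢ i

blockMax-attained : ∀ (h : Fin n → ℤ) {bs} (bs≢ : All Nonempty bs) i →
                    ∃[ v ] v ∈ lookup bs i × blockMax h bs≢ i ≡ h v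
blockMax-attained h (W≢∅ ∷ _)   zero    = maxOn-attained h W≢∅
blockMax-attained h (_   ∷ bs≢) (suc i) = blockMax-attained h bs≢ i

-- The box is a product of intervals, and the interval of each block supplies the factor of that
-- block.
length-box-blockMax : ∀ (h : Fin n → ℤ) m {bs} (bs≢ : All Nonempty bs) →
  + length (box (blockMax h bs≢) m) ≡
  foldr _*_ 1ℤ (All.reduce (λ {W} W≢∅ → (m - maxOn h W W≢∅) ⁺) bs≢)
length-box-blockMax h m [] = refl
length-box-blockMax h m (_∷_ {x = W} W≢∅ bs≢) = begin
  + length (box (blockMax h (W≢∅ ∷ bs≢)) m)  ≡⟨ cong +_ (length-cartesianProductWith _ first rest) ⟩
  + (length first ℕ.* length rest)           ≡⟨ ℤ.pos-* (length first) (length rest) ⟩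
  + length first * + length rest             ≡⟨ cong₂ _*_ (length-interval (maxOn h W W≢∅) m)
                                                         (length-box-blockMax h m bs≢) ⟩
  _                                          ∎
  where
  open ≡-Reasoning
  first = interval (maxOn h W W≢∅) m
  rest = box (blockMax h bs≢) m

-- Monochromatic components

ConstantOn : List (Subset n) → Pred (Fin n → ℤ) 0ℓ
ConstantOn bs x = ∀ {W} → W L.∈ bs → ∀ {u v} → u ∈ W → v ∈ W → x u ≡ x v

module _ (Γ : Graph n) (x : Fin n → ℤ) where

  Monochromatic : Rel (Fin n) 0ℓ
  Monochromatic u v = Adjacent Γ u v × x u ≡ x v

  monochromatic-sym : B.Symmetric Monochromatic
  monochromatic-sym ((e , uv) , xu≡xv) = (e , Sum.swap uv) , sym xu≡xv

  linked? : B.Decidable (Star Monochromatic)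
  linked? = star? λ u v → adjacent? Γ u v ×-dec (x u ℤ.≟ x v)

  linked-sym : B.Symmetric (Star Monochromatic)
  linked-sym = Star.reverse monochromatic-sym

  linked⇒≡ : ∀ {u v} → Star Monochromatic u v → x u ≡ x v
  linked⇒≡ = Star.fold (λ u v → x u ≡ x v) (λ (_ , xu≡xv) → trans xu≡xv) refl

  component : Fin n → Subset n
  component v = Vec.tabulate λ u → does (linked? v u)

  ∈-component⁺ : ∀ {u v} → Star Monochromatic v u → u ∈ component v
  ∈-component⁺ {u} {v} l = Vec.lookup⇒[]= u _
    (trans (Vec.lookup∘tabulate _ u) (dec-true (linked? v u) l))

  ∈-component⁻ : ∀ {u v} → u ∈ component v → Star Monochromatic v u
  ∈-component⁻ {u} {v} u∈ = from (linked? v u)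
    (trans (sym (Vec.lookup∘tabulate (λ u → does (linked? v u)) u)) (Vec.[]=⇒lookup u∈))
    where
    from : (d : Dec P) → does d ≡ true → P
    from (yes p) _ = p

  isComponent? : Decidable λ W → ∃[ v ] W ≡ component v
  isComponent? W = any? λ v → Vec.≡-dec _≟ᵇ_ W (component v)

  -- Filtering all subsets, rather than mapping `component` over the vertices, lists a component
  -- once even when it has several vertices.
  componentList : List (Subset n)
  componentList = filter isComponent? (subsets n)

  ∈-componentList⁺ : ∀ v → component v L.∈ componentList
  ∈-componentList⁺ v = L.∈-filter⁺ isComponent? (∈-subsets _) (v , refl)

  ∈-componentList⁻ : ∀ {W} → W L.∈ componentList → ∃[ v ] W ≡ component v
  ∈-componentList⁻ = proj₂ ∘ L.∈-filter⁻ isComponent? {xs = subsets n}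

  component-connected : ∀ v → InducesConnected Γ (component v)
  component-connected v u w u∈ w∈ =
    go (∈-component⁻ u∈) (linked-sym (∈-component⁻ u∈) ◅◅ ∈-component⁻ w∈)
    where
    -- The link from `v` is extended along the walk and certifies that each vertex passed lies in
    -- `component v`.
    go : ∀ {u w} → Star Monochromatic v u → Star Monochromatic u w →
         Star (AdjacentIn Γ (component v)) u w
    go l ε = ε
    go l (e ◅ es) = (∈-component⁺ l , ∈-component⁺ l′ , proj₁ e) ◅ go l′ es
      where l′ = l ◅◅ e ◅ ε

  -- Any `t` in the first component is reached from `v` by way of `w` and then `u`. Used in both
  -- directions, this makes components that meet equal.
  component-⊆ : ∀ {u v w} → w ∈ component u → w ∈ component v → component u ⊆ component v
  component-⊆ w∈u w∈v t∈u =
    ∈-component⁺ (∈-component⁻ w∈v ◅◅ linked-sym (∈-component⁻ w∈u) ◅◅ ∈-component⁻ t∈u)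

  componentList-disjoint : AllPairs Disjoint componentList
  componentList-disjoint =
    apart (All.tabulate ∈-componentList⁻) (≡-Unique.filter⁺ isComponent? (subsets-unique n))
    where
    apart : ∀ {Ws} → All (λ W → ∃[ v ] W ≡ component v) Ws → Unique (setoid (Subset n)) Ws →
            AllPairs Disjoint Ws
    apart [] [] = []
    apart ((_ , refl) ∷ components) (V≢ ∷ u) = All.zipWith
      (λ { ((_ , refl) , V≢W) (_ , w∈) → let (w∈V , w∈W) = x∈p∩q⁻ _ _ w∈ in
           V≢W (⊆-antisym (component-⊆ w∈V w∈W) (component-⊆ w∈W w∈V)) })
      (components , V≢) ∷ apart components u

  components : ConnectedPartition Γ
  components = componentList , record
    { nonempty  = All.tabulate λ W∈ → let (v , W≡) = ∈-componentList⁻ W∈ in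
                    v , subst (v ∈_) (sym W≡) (∈-component⁺ ε)
    ; disjoint  = componentList-disjoint
    ; covering  = λ v → L.lose (∈-componentList⁺ v) (∈-component⁺ ε)
    ; connected = All.tabulate λ W∈ → let (v , W≡) = ∈-componentList⁻ W∈ in
                    subst (InducesConnected Γ) (sym W≡) (component-connected v)
    }

  -- Each block lies in the component of some `w`, and monochromatic links from `w` preserve the
  -- value of `x`.
  ≤components⇒constant : ∀ π → _≤_ Γ π components → ConstantOn (blocks π) x
  ≤components⇒constant π π≤ W∈ u∈W v∈W =
    let (V , V∈ , W⊆V) = L.find (All.lookup π≤ W∈)
        (w , V≡)       = ∈-componentList⁻ V∈
        link           = λ {u} u∈W → linked⇒≡ (∈-component⁻ {u} (subst (u ∈_) V≡ (W⊆V u∈W)))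
    in trans (sym (link u∈W)) (link v∈W)

  -- Connectedness of blocks enters here: a path inside a block where `x` is constant has only
  -- monochromatic edges, so the block lies in one component.
  constant⇒≤components : ∀ π → ConstantOn (blocks π) x → _≤_ Γ π components
  constant⇒≤components (_ , p) const = All.tabulate λ W∈ →
    let (u , u∈W) = All.lookup nonempty W∈ in
    L.lose (∈-componentList⁺ u) λ {v} v∈W → ∈-component⁺
      (Star.map (λ (a∈W , b∈W , ab) → ab , const W∈ a∈W b∈W)
        (All.lookup connected W∈ u v u∈W v∈W))
    where open IsConnectedPartition p

  Proper : Set
  Proper = ∀ u v → u ≢ v → Adjacent Γ u v → x u ≢ x v

  proper⇒components≤0̂ : Proper → _≤_ Γ components 0̂
  proper⇒components≤0̂ proper = All.tabulate λ W∈ → let (v , W≡) = ∈-componentList⁻ W∈ in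
    L.lose (L.∈-map⁺ ⁅_⁆ (L.∈-allFin v)) λ {u} u∈W →
      subst (_∈ ⁅ v ⁆) (linked⇒same (∈-component⁻ (subst (u ∈_) W≡ u∈W))) (x∈⁅x⁆ v)
    where
    -- A monochromatic edge must be a loop, since properness excludes distinct endpoints.
    step : ∀ {u v} → Monochromatic u v → u ≡ v
    step {u} {v} (uv , xu≡xv) with u ≟ v
    ... | yes u≡v = u≡v
    ... | no  u≢v = contradiction xu≡xv (proper u v u≢v uv)

    linked⇒same : ∀ {u v} → Star Monochromatic u v → u ≡ v
    linked⇒same = Star.fold _≡_ (trans ∘ step) refl

  -- A monochromatic edge would put both its ends into one component, which is contained in a
  -- singleton.
  components≤0̂⇒proper : _≤_ Γ components 0̂ → Proper
  components≤0̂⇒proper ≤0̂ u v u≢v uv xu≡xv =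
    let (W , W∈ , ⊆W) = L.find (All.lookup ≤0̂ (∈-componentList⁺ u))
        (w , _ , W≡)  = L.∈-map⁻ ⁅_⁆ W∈
        in-w          = λ {t} t∈ → x∈⁅y⁆⇒x≡y {x = t} w (subst (t ∈_) W≡ (⊆W t∈))
    in u≢v (trans (in-w (∈-component⁺ ε)) (sym (in-w (∈-component⁺ ((uv , xu≡xv) ◅ ε)))))

-- Exchanging summations

module _ (Γ : Graph n) (h : Fin n → ℤ) (m : ℤ) where

  Admissible : ConnectedPartition Γ → Pred (Fin n → ℤ) 0ℓ
  Admissible π x = InRange h m x × ConstantOn (blocks π) x

  -- Constancy on the blocks is decided through the equivalent comparison of `π` with
  -- `components Γ x`.
  admissible? : ∀ π → Decidable (Admissible π)
  admissible? π x = map′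
    (λ (r , π≤) → r , ≤components⇒constant Γ x π π≤)
    (λ (r , const) → r , constant⇒≤components Γ x π const)
    (inRange? h m x ×-dec _≤?_ Γ π (components Γ x))

  admissible-resp : ∀ π {x y} → x ≗ y → Admissible π x → Admissible π y
  admissible-resp π x≗y (r , const) =
    (λ v → subst (h v ℤ.<_) (x≗y v) (proj₁ (r v)) , subst (ℤ._≤ m) (x≗y v) (proj₂ (r v))) ,
    λ W∈ u∈W v∈W → trans (sym (x≗y _)) (trans (const W∈ u∈W v∈W) (x≗y _))

  module _ (π : ConnectedPartition Γ) where
    open IsConnectedPartition (proj₂ π)

    private
      representative : ∀ i → Nonempty (lookup (blocks π) i)
      representative i = All.lookup nonempty (L.∈-lookup i)

      -- Composition with `rep` and with `block` translates between admissible functions on vertices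
      -- and functions on block positions.
      rep : Fin (length (blocks π)) → Fin n
      rep = proj₁ ∘ representative

      block : Fin n → Fin (length (blocks π))
      block v = Any.index (covering v)

      ∈-block : ∀ v → v ∈ lookup (blocks π) (block v)
      ∈-block v = Any.lookup-index (covering v)

      block-unique : ∀ {v i} → v ∈ lookup (blocks π) i → block v ≡ i
      block-unique {v} {i} v∈ =
        [ id , (λ V∩W≡∅ → contradiction (v , x∈p∩q⁺ (∈-block v , v∈)) V∩W≡∅) ]′
        (AllPairs-lookup (λ V∩W≡∅ (w , w∈) → let (w∈W , w∈V) = x∈p∩q⁻ _ _ w∈ in
            V∩W≡∅ (w , x∈p∩q⁺ (w∈V , w∈W))) disjoint (block v) i)

      max = blockMax h nonempty

    -- An admissible `x` is determined by its values at the representatives. Such a value exceeds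
    -- the maximum of `h` on the block, since `x` takes the same value at a vertex attaining it.
    #admissible≤#box : length (filter (admissible? π) (box h m)) ℕ.≤ length (box max m)
    #admissible≤#box = length-≤ (Fin n →-setoid ℤ) (Fin _ →-setoid ℤ)
      (All.all-filter (admissible? π) (box h m))
      (Unique.filter⁺ (Fin n →-setoid ℤ) (admissible? π) (box-unique h m))
      (_∘ rep) injective into
      where
      const-rep : ∀ {x} → Admissible π x → ∀ v → x v ≡ x (rep (block v))
      const-rep (_ , const) v =
        const (L.∈-lookup (block v)) (∈-block v) (proj₂ (representative (block v)))

      injective : ∀ {x y} → Admissible π x → Admissible π y → x ∘ rep ≗ y ∘ rep → x ≗ y
      injective ax ay eq v = trans (const-rep ax v) (trans (eq (block v)) (sym (const-rep ay v)))

      into : ∀ {x} → Admissible π x → Any (x ∘ rep ≗_) (box max m)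
      into {x} (r , const) = let (y , y∈ , eq) = box-complete range in L.lose y∈ eq
        where
        range : InRange max m (x ∘ rep)
        range i = let (w , w∈ , max≡) = blockMax-attained h nonempty i in
          subst₂ ℤ._<_ (sym max≡) (const (L.∈-lookup i) w∈ (proj₂ (representative i))) (proj₁ (r w)) ,
          proj₂ (r (rep i))

    -- Spreading each value over its block is injective because `block (rep i)` is `i`, and stays in
    -- range because `h` is at most its maximum on the block.
    #box≤#admissible : length (box max m) ℕ.≤ length (filter (admissible? π) (box h m))
    #box≤#admissible = length-≤ (Fin _ →-setoid ℤ) (Fin n →-setoid ℤ)
      (All.tabulate box-sound) (box-unique max m) (_∘ block) injective into
      where
      injective : ∀ {c d} → InRange max m c → InRange max m d → c ∘ block ≗ d ∘ block → c ≗ d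
      injective {c} {d} _ _ eq i = subst (λ i → c i ≡ d i)
        (block-unique (proj₂ (representative i))) (eq (rep i))

      into : ∀ {c} → InRange max m c → Any (c ∘ block ≗_) (filter (admissible? π) (box h m))
      into {c} r = let (y , y∈ , eq) = box-complete (proj₁ admissible) in
        L.lose (L.∈-filter⁺ (admissible? π) y∈ (admissible-resp π eq admissible)) eq
        where
        same : ∀ {W} → W L.∈ blocks π → ∀ {u v} → u ∈ W → v ∈ W → block u ≡ block v
        same W∈ u∈W v∈W = trans (block-unique (subst (_ ∈_) (Any.lookup-index W∈) u∈W))
          (sym (block-unique (subst (_ ∈_) (Any.lookup-index W∈) v∈W)))

        admissible : Admissible π (c ∘ block)
        admissible =
          (λ v → ℤ.≤-<-trans (blockMax-upper h nonempty (block v) (∈-block v)) (proj₁ (r (block v))) ,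
                 proj₂ (r (block v))) ,
          λ W∈ u∈W v∈W → cong c (same W∈ u∈W v∈W)

    ∑-admissible : ∑ (box h m) (𝟙 ∘ admissible? π) ≡
                   ∏-blocks π (λ W W≢∅ → (m - maxOn h W W≢∅) ⁺)
    ∑-admissible = begin
      ∑ (box h m) (𝟙 ∘ admissible? π)
        ≡⟨ length-filter (admissible? π) (box h m) ⟨
      + length (filter (admissible? π) (box h m))
        ≡⟨ cong +_ (ℕ.≤-antisym #admissible≤#box #box≤#admissible) ⟩
      + length (box max m)
        ≡⟨ length-box-blockMax h m nonempty ⟩
      ∏-blocks π (λ W W≢∅ → (m - maxOn h W W≢∅) ⁺) ∎
      where open ≡-Reasoning

  -- For `x` in range, both sides indicate that `π[x]` is `0̂`: the right one by `∑-μ`, as `0̂` is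
  -- least. Out of range both sides vanish; this case is included because `∑-cong` asks for equality
  -- at every function.
  𝟙-isColouring : ∀ x → 𝟙 (isColouring? Γ h m x) ≡ ∑[ π ∈ Π Γ ] (μ 0̂ π * 𝟙 (admissible? π x))
  𝟙-isColouring x = go (inRange? h m x)
    where
    open ≡-Reasoning
    _≟ᴾ_ = DecPoset._≟_ (Π-poset Γ)
    π[x] = components Γ x

    colouring⇒0̂ : IsColouring Γ h m x → _≈_ Γ 0̂ π[x]
    colouring⇒0̂ c = ≤-antisym Γ {0̂} {π[x]} (0̂-least π[x])
      (proper⇒components≤0̂ Γ x (IsColouring.proper c))

    0̂⇒colouring : InRange h m x → _≈_ Γ 0̂ π[x] → IsColouring Γ h m x
    0̂⇒colouring r (f , g) = record
      { inRange = r
      ; proper  = components≤0̂⇒proper Γ x (≤-reflexive Γ {π[x]} {0̂} (g , f))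
      }

    go : Dec (InRange h m x) →
         𝟙 (isColouring? Γ h m x) ≡ ∑[ π ∈ Π Γ ] (μ 0̂ π * 𝟙 (admissible? π x))
    go (no ¬r) = trans (𝟙-no (isColouring? Γ h m x) (¬r ∘ IsColouring.inRange))
      (sym (∑-zero (elements (Π Γ)) λ π →
        trans (cong (μ 0̂ π *_) (𝟙-no (admissible? π x) (¬r ∘ proj₁))) (ℤ.*-zeroʳ (μ 0̂ π))))
    go (yes r) = begin
      𝟙 (isColouring? Γ h m x)
        ≡⟨ 𝟙-cong (isColouring? Γ h m x) (0̂ ≟ᴾ π[x]) colouring⇒0̂ (0̂⇒colouring r) ⟩
      𝟙 (0̂ ≟ᴾ π[x])
        ≡⟨ ∑-μ (Π-poset Γ) (Π Γ) {0̂} {π[x]} (0̂-least π[x]) ⟨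
      ∑[ π ∈ Π Γ ] (μ 0̂ π * 𝟙 (_≤?_ Γ π π[x]))
        ≡⟨ ∑-cong (elements (Π Γ)) (λ π → cong (μ 0̂ π *_)
             (𝟙-cong (_≤?_ Γ π π[x]) (admissible? π x)
               (λ π≤ → r , ≤components⇒constant Γ x π π≤)
               (constant⇒≤components Γ x π ∘ proj₂))) ⟩
      ∑[ π ∈ Π Γ ] (μ 0̂ π * 𝟙 (admissible? π x)) ∎

corollary5p1 : (n : ℕ) (Γ : Graph n) (h : Fin n → ℤ) (m : ℤ) →
    + χ Γ h m ≡ (∑[ π ∈ Π Γ ] (μ 0̂ π * ∏-blocks π (λ W W≢∅ → (m - maxOn h W W≢∅) ⁺)))
corollary5p1 n Γ h m = begin
  + χ Γ h m
    -- The enumeration behind `χ` selects the colourings from this very box, so the count unfolds to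
    -- a sum of indicators.
    ≡⟨ length-satisfying (isColouring? Γ h m) (box h m) ⟩
  ∑ (box h m) (λ x → 𝟙 (isColouring? Γ h m x))
    ≡⟨ ∑-cong (box h m) (𝟙-isColouring Γ h m) ⟩
  ∑ (box h m) (λ x → ∑[ π ∈ Π Γ ] (μ 0̂ π * 𝟙 (admissible? Γ h m π x)))
    ≡⟨ ∑-swap (box h m) (elements (Π Γ)) _ ⟩
  ∑[ π ∈ Π Γ ] ∑ (box h m) (λ x → μ 0̂ π * 𝟙 (admissible? Γ h m π x))
    ≡⟨ ∑-cong (elements (Π Γ)) (λ π → trans (∑-*ˡ (box h m) (μ 0̂ π) _)
         (cong (μ 0̂ π *_) (∑-admissible Γ h m π))) ⟩
  ∑[ π ∈ Π Γ ] (μ 0̂ π * ∏-blocks π (λ W W≢∅ → (m - maxOn h W W≢∅) ⁺)) ∎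
  where open ≡-Reasoning
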